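{- There exists a finite planar graph $G$ such that the vertices of $G$ cannot be non-repetitively coloured using fewer than seven colours; that is, every non-repetitive vertex colouring of $G$ uses at least seven colours.
   Context: A finite sequence $a_1a_2\cdots a_n$ is called non-repetitive if it contains no two identical adjacent blocks, i.e. there are no $i$ and $m\ge 1$ with $i+2m-1\le n$ and $a_{i+j}=a_{i+m+j}$ for all $0\le j<m$. A vertex colouring of a graph $G$ is called non-repetitive if for every path $v_1v_2\cdots v_n$ in $G$ with distinct vertices, the sequence of colours of $v_1,\dots,v_n$ is non-repetitive. -}

module Defs where

open import Data.Fin using (Fin)
open import Data.List using (List; []; _∷_; _++_; [_]; map; reverse)
open import Data.List.Relation.Unary.Linked using (Linked)
open import Data.List.Relation.Unary.Unique.Propositional using (Unique)
open import Data.Nat using (ℕ)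
open import Data.Product using (_×_; _,_; ∃-syntax; Σ-syntax)
open import Data.Rational using (ℚ; 0ℚ; 1ℚ; _+_; _-_; _*_; _≤_)
open import Data.Sum using (_⊎_)
open import Function using (_↔_)
open import Function.Definitions using (Injective)
open import Level using (0ℓ)
open import Relation.Binary using (Rel; Symmetric; Irreflexive; Decidable)
open import Relation.Binary.PropositionalEquality using (_≡_; _≢_)
open import Relation.Nullary using (¬_)

record FiniteGraph : Set₁ where
  infix 4 _~_ _~?_
  field
    V      : Set
    order  : ℕ
    finite : V ↔ Fin order
    _~_    : Rel V 0ℓ
    _~?_   : Decidable _~_
    ~-sym    : Symmetric _~_
    ~-irrefl : Irreflexive _≡_ _~_

NonRepetitive : {A : Set} → List A → Set
NonRepetitive {A} as =
  ¬ (∃[ ps ] ∃[ bs ] ∃[ qs ] bs ≢ [] × as ≡ ps ++ bs ++ bs ++ qs)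

module _ (G : FiniteGraph) where
  open FiniteGraph G

  IsPath : List V → Set
  IsPath vs = Linked _~_ vs × Unique vs

  IsNonRepetitiveColouring : {C : Set} → (V → C) → Set
  IsNonRepetitiveColouring c = ∀ vs → IsPath vs → NonRepetitive (map c vs)

  -- c need not be surjective, so this says that at most k colours suffice.
  NonRepetitivelyColourable : ℕ → Set
  NonRepetitivelyColourable k = Σ[ c ∈ (V → Fin k) ] IsNonRepetitiveColouring c

-- Planarity is the existence of a crossing-free drawing with polygonal edges
-- and rational coordinates.  Every planar graph has such a drawing.  Rational
-- points suffice to detect crossings: two segments with rational endpoints
-- that meet in ℝ² also meet in a rational point.

Point : Set
Point = ℚ × ℚ

lerp : Point → Point → ℚ → Point
lerp (x₁ , y₁) (x₂ , y₂) t = x₁ + t * (x₂ - x₁) , y₁ + t * (y₂ - y₁)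

-- Passes ps t x: the polygonal curve with successive corners ps is at x at
-- time t, when each segment is traversed in one unit of time.
data Passes : List Point → ℚ → Point → Set where
  here  : ∀ {p q ps t x} → 0ℚ ≤ t → t ≤ 1ℚ → x ≡ lerp p q t →
          Passes (p ∷ q ∷ ps) t x
  there : ∀ {p q ps t x} → Passes (q ∷ ps) t x →
          Passes (p ∷ q ∷ ps) (1ℚ + t) x

_liesOn_ : Point → List Point → Set
x liesOn ps = ∃[ t ] Passes ps t x

-- Rules out both self-intersections and degenerate segments.
IsArc : List Point → Set
IsArc ps = ∀ {s t x} → Passes ps s x → Passes ps t x → s ≡ t

record PlaneDrawing (G : FiniteGraph) : Set where
  open FiniteGraph G
  field
    pos   : V → Point
    bends : V → V → List Point  -- only relevant for adjacent vertices

  curve : V → V → List Point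
  curve u v = pos u ∷ bends u v ++ [ pos v ]

  field
    pos-injective : Injective _≡_ _≡_ pos
    bends-sym     : ∀ {u v} → u ~ v → bends v u ≡ reverse (bends u v)
    curve-arc     : ∀ {u v} → u ~ v → IsArc (curve u v)
    avoids-vertices : ∀ {u v} → u ~ v → ∀ w → pos w liesOn curve u v →
                      w ≡ u ⊎ w ≡ v
    -- By avoids-vertices, the vertex w is then a common end of both edges.
    no-crossing   : ∀ {u v u′ v′} → u ~ v → u′ ~ v′ →
                    ∀ x → x liesOn curve u v → x liesOn curve u′ v′ →
                    ((u ≡ u′ × v ≡ v′) ⊎ (u ≡ v′ × v ≡ u′))
                    ⊎ (∃[ w ] x ≡ pos w)

Planar : FiniteGraph → Set
Planar = PlaneDrawing

{-# OPTIONS --safe #-}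

-- The triaugmented triangular prism (a triangular prism with a cap on each of
-- its quadrilateral faces) is planar and has nine vertices.  In a
-- non-repetitive colouring no colour class contains an edge, and no path
-- a x b y has a, b in one class and x, y in another.  Building a partition
-- into at most six classes with these two properties vertex by vertex, without
-- naming the colours, gets stuck after a few dozen steps.
module Submission where

open import Algebra.Properties.Group using (∙-cancelˡ; x∙y⁻¹≈ε⇒x≈y)
open import Data.Fin using (Fin; zero; suc)
import Data.Fin.Properties as Fin
open import Data.Integer using (+_)
open import Data.List using (List; []; _∷_; length; lookup; map; allFin)
open import Data.List.Membership.Propositional using (_∈_)
open import Data.List.Membership.Propositional.Properties using (∈-lookup)
open import Data.List.Relation.Binary.Pointwise using (Pointwise; []; _∷_; Pointwise-length)
open import Data.List.Relation.Unary.All as All using (All; []; _∷_)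
open import Data.List.Relation.Unary.All.Properties using (¬Any⇒All¬)
open import Data.List.Relation.Unary.AllPairs using ([]; _∷_)
open import Data.List.Relation.Unary.Any as Any using (Any; here; there)
import Data.List.Relation.Unary.Any.Properties as Any
open import Data.List.Relation.Unary.Linked using ([-]; _∷_)
open import Data.List.Relation.Unary.Unique.Propositional using (Unique)
open import Data.Nat using (ℕ; _<_; _≤_; _<?_; s≤s⁻¹)
import Data.Nat.Properties as ℕ
open import Data.Product using (_×_; _,_; ∃-syntax; ∃₂; proj₁; proj₂)
open import Data.Product.Properties using (≡-dec)
open import Data.Rational as ℚ using (ℚ; 0ℚ; 1ℚ; _+_; _-_; _*_; -_; positive; nonNegative)
open import Data.Rational.Literals using (fromℤ)
import Data.Rational.Properties as ℚ
open import Data.Rational.Solver using (module +-*-Solver)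
open import Data.Sum using (_⊎_; inj₁; inj₂; [_,_]′)
open import Function using (_∘_; id)
open import Function.Construct.Identity using (↔-id)
open import Function.Definitions using (Injective)
open import Relation.Binary using (DecidableEquality)
open import Relation.Binary.PropositionalEquality
open import Relation.Nullary using (¬_; Dec; yes; no; contradiction; ¬?; _×-dec_; _⊎-dec_; _→-dec_)
open import Relation.Nullary.Decidable using (from-yes)
open import Defs

open +-*-Solver using (solve; _:=_; _:+_; _:-_; _:*_; con)

-- Pigeonhole principle for lists of colours

lookup-injective : {A : Set} {xs : List A} → Unique xs → Injective _≡_ _≡_ (lookup xs)
lookup-injective {xs = _ ∷ _} _ {zero} {zero} _ = refl
lookup-injective {xs = _ ∷ xs} (x∉ ∷ _) {zero}  {suc j} eq =
  contradiction eq (All.lookup x∉ (∈-lookup {xs = xs} j))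
lookup-injective {xs = _ ∷ xs} (x∉ ∷ _) {suc i} {zero}  eq =
  contradiction (sym eq) (All.lookup x∉ (∈-lookup {xs = xs} i))
lookup-injective {xs = _ ∷ _} (_ ∷ un) {suc _} {suc _} eq = cong suc (lookup-injective un eq)

-- For distinct entries, `lookup` is an injection of the index set into `Fin k`.
unique⇒length≤ : ∀ {k} {ds : List (Fin k)} → Unique ds → length ds ≤ k
unique⇒length≤ un = Fin.injective⇒≤ (lookup-injective un)

-- Search through partitions into colour classes

insertions : {A : Set} → A → List (List A) → List (List (List A))
insertions v []       = []
insertions v (C ∷ cs) = ((v ∷ C) ∷ cs) ∷ map (C ∷_) (insertions v cs)

module Search (G : FiniteGraph) (_≟_ : DecidableEquality (FiniteGraph.V G)) where
  open FiniteGraph G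

  ~⇒≢ : ∀ {u v} → u ~ v → u ≢ v
  ~⇒≢ u~v u≡v = ~-irrefl u≡v u~v

  -- Adjacent vertices differ by irreflexivity, so distinctness of all four needs only three more
  -- inequalities. The third, `a ≢ b`, is tested in `Alternating` before `x` and `y` are searched
  -- for.
  AlternatingPath : V → V → V → V → Set
  AlternatingPath a x b y = a ~ x × x ~ b × b ~ y × a ≢ y × x ≢ y

  Alternating : List V → List V → Set
  Alternating C D =
    Any (λ a → Any (λ b → a ≢ b × Any (λ x → Any (AlternatingPath a x b) D) D) C) C

  Conflict : List (List V) → Set
  Conflict cs = Any (λ C → Any (λ a → Any (a ~_) C) C) cs
              ⊎ Any (λ C → Any (Alternating C) cs) cs

  alternatingPath? : ∀ a x b y → Dec (AlternatingPath a x b y)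
  alternatingPath? a x b y =
    a ~? x ×-dec x ~? b ×-dec b ~? y ×-dec ¬? (a ≟ y) ×-dec ¬? (x ≟ y)

  alternating? : ∀ C D → Dec (Alternating C D)
  alternating? C D =
    Any.any? (λ a → Any.any? (λ b → ¬? (a ≟ b) ×-dec
      Any.any? (λ x → Any.any? (alternatingPath? a x b) D) D) C) C

  conflict? : ∀ cs → Dec (Conflict cs)
  conflict? cs = Any.any? (λ C → Any.any? (λ a → Any.any? (a ~?_) C) C) cs
           ⊎-dec Any.any? (λ C → Any.any? (alternating? C) cs) cs

  -- No partition that extends cs by the vertices vs has at most k classes
  -- and no conflict.
  Refuted : ℕ → List V → List (List V) → Set
  Refuted k []       cs = Conflict cs ⊎ k < length cs
  Refuted k (v ∷ vs) cs =
    Conflict cs ⊎ k < length cs ⊎ All (Refuted k vs) (((v ∷ []) ∷ cs) ∷ insertions v cs)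

  refuted? : ∀ k vs cs → Dec (Refuted k vs cs)
  refuted? k []       cs = conflict? cs ⊎-dec k <? length cs
  refuted? k (v ∷ vs) cs =
    conflict? cs ⊎-dec k <? length cs ⊎-dec All.all? (refuted? k vs) _

  -- The branch of the search followed by a colouring

  module _ {k} {c : V → Fin k} (nonRep : IsNonRepetitiveColouring G c) where

    HasColour : Fin k → List V → Set
    HasColour d C = All (λ v → c v ≡ d) C

    -- Otherwise the path `u`, `v` repeats a block of length one.
    adjacent⇒≢ : ∀ {u v} → u ~ v → c u ≢ c v
    adjacent⇒≢ {u} {v} u~v eq =
      nonRep (u ∷ v ∷ []) (u~v ∷ [-] , (~⇒≢ u~v ∷ []) ∷ [] ∷ [])
        ([] , c u ∷ [] , [] , (λ ()) , cong (λ d → c u ∷ d ∷ []) (sym eq))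

    -- The colours along the path are the block `c a`, `c x` twice over.
    alternatingPath⇒⊥ : ∀ {a x b y} → c a ≡ c b → c x ≡ c y → a ≢ b → ¬ AlternatingPath a x b y
    alternatingPath⇒⊥ {a} {x} {b} {y} ca≡cb cx≡cy a≢b (a~x , x~b , b~y , a≢y , x≢y) =
      nonRep (a ∷ x ∷ b ∷ y ∷ [])
        (a~x ∷ x~b ∷ b~y ∷ [-] ,
          (~⇒≢ a~x ∷ a≢b ∷ a≢y ∷ []) ∷ (~⇒≢ x~b ∷ x≢y ∷ []) ∷ (~⇒≢ b~y ∷ []) ∷ [] ∷ [])
        ([] , c a ∷ c x ∷ [] , [] , (λ ()) ,
          cong₂ (λ d e → c a ∷ c x ∷ d ∷ e ∷ []) (sym ca≡cb) (sym cx≡cy))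

    alternating⇒⊥ : ∀ {d e C D} → HasColour d C → HasColour e D → ¬ Alternating C D
    alternating⇒⊥ hC hD alt =
      let (ca , alt₁)       = All.lookupAny hC alt
          (cb , a≢b , alt₂) = All.lookupAny hC alt₁
          (cx , alt₃)       = All.lookupAny hD alt₂
          (cy , path)       = All.lookupAny hD alt₃
      in alternatingPath⇒⊥ (trans ca (sym cb)) (trans cx (sym cy)) a≢b path

    colourOf : ∀ {P : List V → Set} {ds cs} → Pointwise HasColour ds cs → Any P cs →
               ∃₂ λ d C → HasColour d C × P C
    colourOf (h ∷ _)  (here p)  = _ , _ , h , p
    colourOf (_ ∷ hs) (there i) = colourOf hs i

    conflict⇒⊥ : ∀ {ds cs} → Pointwise HasColour ds cs → ¬ Conflict cs
    conflict⇒⊥ hs (inj₁ edge) =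
      let (_ , _ , h , i) = colourOf hs edge
          (cu , j)        = All.lookupAny h i
          (cv , u~v)      = All.lookupAny h j
      in adjacent⇒≢ u~v (trans cu (sym cv))
    conflict⇒⊥ hs (inj₂ i) =
      let (_ , _ , hC , j)   = colourOf hs i
          (_ , _ , hD , alt) = colourOf hs j
      in alternating⇒⊥ hC hD alt

    -- Colours and classes are paired by position, so the position of `c v` in `ds` tells which
    -- class `v` joins.
    insertion : ∀ {v ds cs} → Pointwise HasColour ds cs → c v ∈ ds →
                Any (Pointwise HasColour ds) (insertions v cs)
    insertion (h ∷ hs) (here eq) = here ((eq ∷ h) ∷ hs)
    insertion (h ∷ hs) (there i) = there (Any.map⁺ (Any.map (h ∷_) (insertion hs i)))

    tooMany⇒⊥ : ∀ {n ds cs} → Unique ds → Pointwise HasColour ds cs → k ≤ n → ¬ n < length cs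
    tooMany⇒⊥ {n} un hs k≤n n< = ℕ.<⇒≱ n<
      (ℕ.≤-trans (subst (_≤ k) (Pointwise-length hs) (unique⇒length≤ un)) k≤n)

    -- Induction down the search tree. The invariant is that `ds` lists distinct colours, one for
    -- each class in `cs`, so both a conflict and an excess of classes contradict the colouring `c`.
    -- Allowing `k ≤ n` lets one search serve all smaller numbers of colours.
    refuted⇒⊥ : ∀ {n ds} vs {cs} → k ≤ n → Unique ds → Pointwise HasColour ds cs →
                ¬ Refuted n vs cs
    refuted⇒⊥ []       k≤n un hs (inj₁ conflict)   = conflict⇒⊥ hs conflict
    refuted⇒⊥ []       k≤n un hs (inj₂ tooMany)    = tooMany⇒⊥ un hs k≤n tooMany
    refuted⇒⊥ (_ ∷ _) k≤n un hs (inj₁ conflict)   = conflict⇒⊥ hs conflict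
    refuted⇒⊥ (_ ∷ _) k≤n un hs (inj₂ (inj₁ tooMany)) = tooMany⇒⊥ un hs k≤n tooMany
    refuted⇒⊥ {ds = ds} (v ∷ vs) k≤n un hs (inj₂ (inj₂ (new ∷ old)))
      -- A fresh colour selects the branch where `v` opens a class; a colour already in `ds` selects
      -- one of the insertions.
      with Any.any? (c v Fin.≟_) ds
    ... | no  cv∉ = refuted⇒⊥ vs k≤n (¬Any⇒All¬ _ cv∉ ∷ un) ((refl ∷ []) ∷ hs) new
    ... | yes cv∈ = let (r , hs′) = All.lookupAny old (insertion hs cv∈)
                    in refuted⇒⊥ vs k≤n un hs′ r

  refuted⇒¬colourable : ∀ {n k} vs → Refuted n vs [] → k ≤ n → ¬ NonRepetitivelyColourable G k
  refuted⇒¬colourable vs r k≤n (c , nonRep) = refuted⇒⊥ nonRep vs k≤n [] [] r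

-- Orientation and intersection of segments

-- Cross product of `q - p` and `r - p`, twice the signed area of the triangle: positive exactly
-- when `r` is strictly left of the directed line from `p` to `q`.
orient : Point → Point → Point → ℚ
orient (px , py) (qx , qy) (rx , ry) = (qx - px) * (ry - py) - (qy - py) * (rx - px)

-- The orientation is affine in its third point.
orient-lerp : ∀ p q r s t →
  orient p q (lerp r s t) ≡ (1ℚ - t) * orient p q r + t * orient p q s
orient-lerp (px , py) (qx , qy) (rx , ry) (sx , sy) t = solve 9
  (λ px py qx qy rx ry sx sy t →
    (qx :- px) :* (ry :+ t :* (sy :- ry) :- py) :- (qy :- py) :* (rx :+ t :* (sx :- rx) :- px) :=
    (con 1ℚ :- t) :* ((qx :- px) :* (ry :- py) :- (qy :- py) :* (rx :- px)) :+
    t :* ((qx :- px) :* (sy :- py) :- (qy :- py) :* (sx :- px)))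
  refl px py qx qy rx ry sx sy t

orient-line : ∀ p q t → orient p q (lerp p q t) ≡ 0ℚ
orient-line (px , py) (qx , qy) t = solve 5
  (λ px py qx qy t →
    (qx :- px) :* (py :+ t :* (qy :- py) :- py) :- (qy :- py) :* (px :+ t :* (qx :- px) :- px) :=
    con 0ℚ)
  refl px py qx qy t

lerp-swap : ∀ p q t → lerp p q t ≡ lerp q p (1ℚ - t)
lerp-swap (px , py) (qx , qy) t = cong₂ _,_ (swap px qx t) (swap py qy t)
  where
  swap : ∀ x y t → x + t * (y - x) ≡ y + (1ℚ - t) * (x - y)
  swap = solve 3 (λ x y t → x :+ t :* (y :- x) := y :+ (con 1ℚ :- t) :* (x :- y)) refl

lerp-0 : ∀ p q → lerp p q 0ℚ ≡ p
lerp-0 (px , py) (qx , qy) = cong₂ _,_ (at-0 px qx) (at-0 py qy)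
  where
  at-0 : ∀ x y → x + 0ℚ * (y - x) ≡ x
  at-0 = solve 2 (λ x y → x :+ con 0ℚ :* (y :- x) := x) refl

lerp-1 : ∀ p q → lerp p q 1ℚ ≡ q
lerp-1 (px , py) (qx , qy) = cong₂ _,_ (at-1 px qx) (at-1 py qy)
  where
  at-1 : ∀ x y → x + 1ℚ * (y - x) ≡ y
  at-1 = solve 2 (λ x y → x :+ con 1ℚ :* (y :- x) := y) refl

scale-injective : ∀ {x y} s t → x ≢ y → x + s * (y - x) ≡ x + t * (y - x) → s ≡ t
scale-injective {x} {y} s t x≢y eq = begin
  s                    ≡⟨ unscale s ⟨
  s * (y - x) * inv    ≡⟨ cong (_* inv) (∙-cancelˡ ℚ.+-0-group x _ _ eq) ⟩
  t * (y - x) * inv    ≡⟨ unscale t ⟩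
  t                    ∎
  where
  open ≡-Reasoning

  invertible = ℚ.#⇒invertible (x≢y ∘ sym)
  inv = proj₁ invertible

  unscale : ∀ r → r * (y - x) * inv ≡ r
  unscale r = trans (ℚ.*-assoc r (y - x) inv)
    (trans (cong (r *_) (proj₂ (proj₂ invertible))) (ℚ.*-identityʳ r))

-- A single coordinate in which `p` and `q` differ already determines the time.
lerp-injective : ∀ {p q} s t → p ≢ q → lerp p q s ≡ lerp p q t → s ≡ t
lerp-injective {px , py} {qx , qy} s t p≢q eq with px ℚ.≟ qx
... | no  px≢qx = scale-injective s t px≢qx (cong proj₁ eq)
... | yes refl  = scale-injective s t (p≢q ∘ cong (px ,_)) (cong proj₂ eq)

-- Both summands are nonnegative, so `w * a` cannot exceed zero, and the positive factor `a`
-- cancels.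
weight-zero : ∀ {w a y} → 0ℚ ℚ.< a → 0ℚ ℚ.≤ w → 0ℚ ℚ.≤ y → w * a + y ≡ 0ℚ → w ≡ 0ℚ
weight-zero {w} {a} {y} 0<a 0≤w 0≤y eq = ℚ.≤-antisym (ℚ.*-cancelʳ-≤-pos a wa≤0a) 0≤w
  where
  instance _ = positive 0<a

  open ℚ.≤-Reasoning

  wa≤0a : w * a ℚ.≤ 0ℚ * a
  wa≤0a = begin
    w * a         ≡⟨ ℚ.+-identityʳ (w * a) ⟨
    w * a + 0ℚ    ≤⟨ ℚ.+-monoʳ-≤ (w * a) 0≤y ⟩
    w * a + y     ≡⟨ eq ⟩
    0ℚ            ≡⟨ ℚ.*-zeroˡ a ⟨
    0ℚ * a        ∎

0≤* : ∀ {x y} → 0ℚ ℚ.≤ x → 0ℚ ℚ.≤ y → 0ℚ ℚ.≤ x * y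
0≤* {x} {y} 0≤x 0≤y = subst (ℚ._≤ x * y) (ℚ.*-zeroˡ y) (ℚ.*-monoʳ-≤-nonNeg y 0≤x)
  where instance _ = nonNegative 0≤y

-- The weak inequalities let the segment from `r` to `s` end on the line, as edges with a common
-- vertex require; the strict one keeps it from running along the line.
LeftOf : Point → Point → Point → Point → Set
LeftOf p q r s = 0ℚ ℚ.≤ orient p q r × 0ℚ ℚ.≤ orient p q s
               × (0ℚ ℚ.< orient p q r ⊎ 0ℚ ℚ.< orient p q s)

leftOf? : ∀ p q r s → Dec (LeftOf p q r s)
leftOf? p q r s = 0ℚ ℚ.≤? orient p q r ×-dec 0ℚ ℚ.≤? orient p q s
            ×-dec (0ℚ ℚ.<? orient p q r ⊎-dec 0ℚ ℚ.<? orient p q s)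

record OnSegment (p q x : Point) : Set where
  constructor at
  field
    time : ℚ
    0≤t  : 0ℚ ℚ.≤ time
    t≤1  : time ℚ.≤ 1ℚ
    x≡   : x ≡ lerp p q time

0≤1- : ∀ {t} → t ℚ.≤ 1ℚ → 0ℚ ℚ.≤ 1ℚ - t
0≤1- {t} t≤1 = subst (ℚ._≤ 1ℚ - t) (ℚ.+-inverseʳ t) (ℚ.+-monoˡ-≤ (- t) t≤1)

1-≤1 : ∀ {t} → 0ℚ ℚ.≤ t → 1ℚ - t ℚ.≤ 1ℚ
1-≤1 {t} 0≤t = ℚ.+-monoʳ-≤ 1ℚ (ℚ.neg-antimono-≤ 0≤t)

onSegment-swap : ∀ {p q x} → OnSegment p q x → OnSegment q p x
onSegment-swap {p} {q} (at t 0≤t t≤1 x≡) =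
  at (1ℚ - t) (0≤1- t≤1) (1-≤1 0≤t) (trans x≡ (lerp-swap p q t))

onSegment⇒onLine : ∀ {p q x} → OnSegment p q x → orient p q x ≡ 0ℚ
onSegment⇒onLine {p} {q} (at t _ _ refl) = orient-line p q t

onSegment : ∀ {p q x} → x liesOn (p ∷ q ∷ []) → OnSegment p q x
onSegment (_ , here 0≤t t≤1 x≡) = at _ 0≤t t≤1 x≡
onSegment (_ , there ())

-- At the meeting point the orientation vanishes, yet it is the average of the orientations of `r`
-- and `s` with weights `1ℚ - t` and `t`. Both terms are nonnegative, so the weight of a strictly
-- left end is zero and the point is the other end.
meet⇒endpoint : ∀ {p q r s x} → LeftOf p q r s → OnSegment p q x → OnSegment r s x →
                x ≡ r ⊎ x ≡ s
meet⇒endpoint {p} {q} {r} {s} (0≤A , 0≤B , 0<A⊎0<B) on (at t 0≤t t≤1 refl) =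
  [ inj₂ ∘ at-s , inj₁ ∘ at-r ]′ 0<A⊎0<B
  where
  balance : (1ℚ - t) * orient p q r + t * orient p q s ≡ 0ℚ
  balance = trans (sym (orient-lerp p q r s t)) (onSegment⇒onLine on)

  at-r : 0ℚ ℚ.< orient p q s → lerp r s t ≡ r
  at-r 0<B = trans (cong (lerp r s) t≡0) (lerp-0 r s)
    where
    t≡0 : t ≡ 0ℚ
    t≡0 = weight-zero 0<B 0≤t (0≤* (0≤1- t≤1) 0≤A) (trans (ℚ.+-comm (t * orient p q s) _) balance)

  at-s : 0ℚ ℚ.< orient p q r → lerp r s t ≡ s
  at-s 0<A = trans (cong (lerp r s) (sym 1≡t)) (lerp-1 r s)
    where
    1≡t : 1ℚ ≡ t
    1≡t = x∙y⁻¹≈ε⇒x≈y ℚ.+-0-group 1ℚ t (weight-zero 0<A (0≤1- t≤1) (0≤* 0≤t 0≤B) balance)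

-- Of two segments that meet at most in endpoints and are not collinear, one
-- lies on one side of the line through the other.
Apart : Point → Point → Point → Point → Set
Apart p q r s = (LeftOf p q r s ⊎ LeftOf q p r s) ⊎ (LeftOf r s p q ⊎ LeftOf s r p q)

apart? : ∀ p q r s → Dec (Apart p q r s)
apart? p q r s =
  (leftOf? p q r s ⊎-dec leftOf? q p r s) ⊎-dec (leftOf? r s p q ⊎-dec leftOf? s r p q)

-- Plane drawings with straight edges

module _ (G : FiniteGraph) where
  open FiniteGraph G

  -- Replaces conditions on all points of the curves by signs of orientations of vertices, which are
  -- decidable. A nonzero orientation keeps a third vertex off the whole line through an edge.
  straightLineDrawing :
    (pos : V → Point) →
    Injective _≡_ _≡_ pos →
    (∀ {u v} → u ~ v → ∀ w → (w ≡ u ⊎ w ≡ v) ⊎ orient (pos u) (pos v) (pos w) ≢ 0ℚ) →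
    (∀ {u v u′ v′} → u ~ v → u′ ~ v′ →
      ((u ≡ u′ × v ≡ v′) ⊎ (u ≡ v′ × v ≡ u′)) ⊎ Apart (pos u) (pos v) (pos u′) (pos v′)) →
    PlaneDrawing G
  straightLineDrawing pos pos-injective offLine apart = record
    { pos             = pos
    ; bends           = λ _ _ → []
    ; pos-injective   = pos-injective
    ; bends-sym       = λ _ → refl
    ; curve-arc       = λ u~v → arc λ eq → ~-irrefl (pos-injective eq) u~v
    ; avoids-vertices = λ u~v w on →
        [ id , contradiction (onSegment⇒onLine (onSegment on)) ]′ (offLine u~v w)
    ; no-crossing     = λ u~v u′~v′ x on on′ →
        [ inj₁ , inj₂ ∘ vertex (onSegment on) (onSegment on′) ]′ (apart u~v u′~v′)
    }
    where
    arc : ∀ {p q} → p ≢ q → IsArc (p ∷ q ∷ [])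
    arc p≢q (here _ _ x≡) (here _ _ x≡′) = lerp-injective _ _ p≢q (trans (sym x≡) x≡′)
    arc p≢q (there ())
    arc p≢q (here _ _ _) (there ())

    isVertex : ∀ {u v x} → x ≡ pos u ⊎ x ≡ pos v → ∃[ w ] x ≡ pos w
    isVertex = [ (_ ,_) , (_ ,_) ]′

    vertex : ∀ {u v u′ v′ x} →
             OnSegment (pos u) (pos v) x → OnSegment (pos u′) (pos v′) x →
             Apart (pos u) (pos v) (pos u′) (pos v′) → ∃[ w ] x ≡ pos w
    vertex on on′ (inj₁ (inj₁ left)) = isVertex (meet⇒endpoint left on on′)
    vertex on on′ (inj₁ (inj₂ left)) = isVertex (meet⇒endpoint left (onSegment-swap on) on′)
    vertex on on′ (inj₂ (inj₁ left)) = isVertex (meet⇒endpoint left on′ on)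
    vertex on on′ (inj₂ (inj₂ left)) = isVertex (meet⇒endpoint left (onSegment-swap on′) on)

-- The capped prism, its drawing and its refutation

-- The cap d_i sits on the face of the prism that avoids a_i and b_i.
pattern a₀ = zero
pattern a₁ = suc a₀
pattern a₂ = suc a₁
pattern b₀ = suc a₂
pattern b₁ = suc b₀
pattern b₂ = suc b₁
pattern d₀ = suc b₂
pattern d₁ = suc d₀
pattern d₂ = suc d₁

-- The degrees sum to 42, so there are 21 = 3 · 9 - 6 edges, the most that a simple planar graph on
-- nine vertices can have.
neighbours : Fin 9 → List (Fin 9)
neighbours a₀ = a₁ ∷ a₂ ∷ b₀ ∷ d₁ ∷ d₂ ∷ []
neighbours a₁ = a₂ ∷ a₀ ∷ b₁ ∷ d₂ ∷ d₀ ∷ []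
neighbours a₂ = a₀ ∷ a₁ ∷ b₂ ∷ d₀ ∷ d₁ ∷ []
neighbours b₀ = b₁ ∷ b₂ ∷ a₀ ∷ d₁ ∷ d₂ ∷ []
neighbours b₁ = b₂ ∷ b₀ ∷ a₁ ∷ d₂ ∷ d₀ ∷ []
neighbours b₂ = b₀ ∷ b₁ ∷ a₂ ∷ d₀ ∷ d₁ ∷ []
neighbours d₀ = a₁ ∷ a₂ ∷ b₁ ∷ b₂ ∷ []
neighbours d₁ = a₂ ∷ a₀ ∷ b₂ ∷ b₀ ∷ []
neighbours d₂ = a₀ ∷ a₁ ∷ b₀ ∷ b₁ ∷ []

cappedPrism : FiniteGraph
cappedPrism = record
  { V        = Fin 9
  ; order    = 9
  ; finite   = ↔-id _
  ; _~_      = _~_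
  ; _~?_     = _~?_
  ; ~-sym    = symmetric _ _
  ; ~-irrefl = λ { {v} refl → loopless v }
  }
  where
  _~_ : Fin 9 → Fin 9 → Set
  u ~ v = v ∈ neighbours u

  _~?_ : ∀ u v → Dec (u ~ v)
  u ~? v = Any.any? (v Fin.≟_) (neighbours u)

  symmetric : ∀ u v → u ~ v → v ~ u
  symmetric = from-yes (Fin.all? λ u → Fin.all? λ v → u ~? v →-dec v ~? u)

  loopless : ∀ v → ¬ (v ~ v)
  loopless = from-yes (Fin.all? λ v → ¬? (v ~? v))

point : ℕ → ℕ → Point
point x y = fromℤ (+ x) , fromℤ (+ y)

-- The affine map (x , y) ↦ (6 - x - y , x) shifts all indices cyclically.
position : Fin 9 → Point
position a₀ = point 0 0
position a₁ = point 6 0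
position a₂ = point 0 6
position b₀ = point 2 1
position b₁ = point 3 2
position b₂ = point 1 3
position d₀ = point 2 3
position d₁ = point 1 2
position d₂ = point 3 1

cappedPrism-planar : Planar cappedPrism
cappedPrism-planar = straightLineDrawing cappedPrism position
  (λ {u} {v} → injective u v) (λ {u} {v} → offLine u v) (λ {u} {v} {u′} {v′} → apart u v u′ v′)
  where
  open FiniteGraph cappedPrism

  injective : ∀ u v → position u ≡ position v → u ≡ v
  injective = from-yes (Fin.all? λ u → Fin.all? λ v →
    ≡-dec ℚ._≟_ ℚ._≟_ (position u) (position v) →-dec u Fin.≟ v)

  offLine : ∀ u v → u ~ v → ∀ w →
            (w ≡ u ⊎ w ≡ v) ⊎ orient (position u) (position v) (position w) ≢ 0ℚ
  offLine = from-yes (Fin.all? λ u → Fin.all? λ v → u ~? v →-dec Fin.all? λ w →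
    (w Fin.≟ u ⊎-dec w Fin.≟ v) ⊎-dec
    ¬? (orient (position u) (position v) (position w) ℚ.≟ 0ℚ))

  apart : ∀ u v u′ v′ → u ~ v → u′ ~ v′ →
          ((u ≡ u′ × v ≡ v′) ⊎ (u ≡ v′ × v ≡ u′)) ⊎
          Apart (position u) (position v) (position u′) (position v′)
  -- All quadruples of vertices are tested by evaluation in exact rational arithmetic; both
  -- adjacency tests come first and dismiss most of them.
  apart = from-yes (Fin.all? λ u → Fin.all? λ v → Fin.all? λ u′ → Fin.all? λ v′ →
    u ~? v →-dec (u′ ~? v′ →-dec
      (((u Fin.≟ u′ ×-dec v Fin.≟ v′) ⊎-dec (u Fin.≟ v′ ×-dec v Fin.≟ u′)) ⊎-dec
      apart? (position u) (position v) (position u′) (position v′))))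

theorem3 : ∃[ G ] Planar G × (∀ k → k < 7 → ¬ NonRepetitivelyColourable G k)
theorem3 = cappedPrism , cappedPrism-planar , λ k k<7 →
  -- The search with six classes is run by evaluation and settles every `k` below seven. `allFin 9`
  -- starts with the triangle `a₀`, `a₁`, `a₂`, which forces three separate classes at once.
  refuted⇒¬colourable (allFin 9) (from-yes (refuted? 6 (allFin 9) [])) (s≤s⁻¹ k<7)
  where open Search cappedPrism Fin._≟_
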